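{- Suppose $L$ is a Latin square of order $n$. Let $\theta=(\alpha,\beta,\gamma)$ be an autotopism of $L$ and let $\Lambda$ be a strongly lcm-closed set. If at least two of $R_\Lambda$, $C_\Lambda$ and $S_\Lambda$ are nonempty, then $|R_\Lambda|=|C_\Lambda|=|S_\Lambda|$ and $L$ contains a subsquare $M$ on the rows $R_\Lambda$, columns $C_\Lambda$ and symbols $S_\Lambda$. Moreover, $M$ admits the autotopism $\theta_M$. In addition, if $|R_\Lambda|=|C_\Lambda|=|S_\Lambda|=\tfrac12 n$ then $L$ has four subsquares, each with autotopisms induced by $\theta$ (by restriction of $\alpha,\beta,\gamma$ to its rows, columns and symbols, respectively). The subsquares are on the rows, columns and symbols $(R_\Lambda,C_\Lambda,S_\Lambda)$, $(R_\Lambda,\overline{C_\Lambda},\overline{S_\Lambda})$, $(\overline{R_\Lambda},C_\Lambda,\overline{S_\Lambda})$ and $(\overline{R_\Lambda},\overline{C_\Lambda},S_\Lambda)$.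
   Context: A Latin square of order $n$ is an $n\times n$ array $L=L(i,j)$ with rows, columns and symbols indexed by $[n]=\{1,\dots,n\}$ such that the symbols in every row and in every column are distinct. A triple $\theta=(\alpha,\beta,\gamma)\in S_n\times S_n\times S_n$ is an autotopism of $L$ if $\gamma(L(i,j))=L(\alpha(i),\beta(j))$ for all $i,j\in[n]$; the same definition applies to Latin squares whose rows, columns and symbols are indexed by arbitrary finite sets $R,C,S$ of equal size, with $\alpha,\beta,\gamma$ permutations of $R,C,S$ respectively. A nonempty subset $\Lambda\subseteq\mathbb N=\{1,2,\dots\}$ (finite or infinite) is strongly lcm-closed if for all $a,b\in\mathbb N$ we have $\mathrm{lcm}(a,b)\in\Lambda$ if and only if $a\in\Lambda$ and $b\in\Lambda$. Given $(\alpha,\beta,\gamma)$ and $\Lambda$, $R_\Lambda$ (respectively $C_\Lambda$, $S_\Lambda$) is the set of $i\in[n]$ such that the length of the cycle of $\alpha$ (respectively $\beta$, $\gamma$) containing $i$ belongs to $\Lambda$; fixed points count as cycles of length $1$. For $X\subseteq[n]$, $\overline X=[n]\setminus X$. A subsquare of $L$ is a submatrix that is itself a Latin square; it is on rows $R$, columns $C$ and symbols $S$ if it is formed by the rows indexed by $R$ and the columns indexed by $C$, and $S=\{L(i,j): i\in R, j\in C\}$, so $|R|=|C|=|S|$. When $R,C,S$ are closed under $\alpha,\beta,\gamma$ respectively, $\theta_M$ denotes the triple of the restrictions of $\alpha,\beta,\gamma$ to $R,C,S$ respectively. -}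

module Defs where

open import Data.Fin.Base using (Fin; toℕ)
open import Data.Fin.Permutation using (Permutation′; _⟨$⟩ʳ_; _⟨$⟩ˡ_; inverseˡ; inverseʳ)
open import Data.Fin.Properties using (_≟_; pigeonhole)
open import Data.Nat.Base using (ℕ; zero; suc; _+_; _<_; s≤s; NonZero)
open import Data.Nat.GeneralisedArithmetic using (fold)
open import Data.Nat.LCM using (lcm)
open import Data.Nat.Properties using (≤-refl)
open import Data.Product.Base using (∃; ∃₂; _×_; _,_; proj₁; proj₂)
open import Data.Sum.Base using (_⊎_)
open import Function.Base using (_∘_)
open import Function.Bundles using (Inverse; Injection; Equivalence; _⇔_)
open import Function.Definitions using (Injective)
open import Level using (Level; _⊔_; 0ℓ)
open import Relation.Binary.Bundles using (Setoid)
open import Relation.Binary.Core using (_Preserves₂_⟶_⟶_)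
import Relation.Binary.Construct.On as On
open import Relation.Binary.PropositionalEquality
  using (_≡_; _≢_; refl; sym; trans; cong; subst)
  renaming (setoid to ≡-setoid)
open import Relation.Nullary using (¬_; yes; no)
open import Relation.Unary using (Pred; Decidable; Satisfiable)

open Setoid using (Carrier)
open Inverse using (to)

private
  variable
    a c ℓ : Level
    n : ℕ

------------------------------------------------------------------------
-- Sets and cardinalities

[_] : ℕ → Setoid 0ℓ 0ℓ
[ n ] = ≡-setoid (Fin n)

-- A subset of [ n ] regarded as a set in its own right.  Two elements are
-- equal when their underlying indices are, whatever the membership proofs,
-- so that bijections really compare numbers of elements.
Sub : Pred (Fin n) ℓ → Setoid ℓ 0ℓ
Sub {n = n} X = On.setoid {B = ∃ X} [ n ] proj₁

SameSize : Setoid a 0ℓ → Setoid c 0ℓ → Set (a ⊔ c)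
SameSize A B = Inverse A B

HasSize : Setoid a 0ℓ → ℕ → Set a
HasSize A k = SameSize A [ k ]

-- "Embeds in some [ m ]".  Classically this is the usual finiteness; it is
-- used in this form because subsets of [ n ] need not be decidable.
Finite : Setoid a 0ℓ → Set a
Finite A = ∃ λ m → Injection A [ m ]

------------------------------------------------------------------------
-- Latin squares and autotopisms

record IsLatinSquare (R C S : Setoid a 0ℓ)
                     (L : Carrier R → Carrier C → Carrier S) : Set a where
  private
    module R = Setoid R
    module C = Setoid C
    module S = Setoid S
  field
    L-cong          : L Preserves₂ R._≈_ ⟶ C._≈_ ⟶ S._≈_
    finite          : Finite R
    |R|≡|C|         : SameSize R C
    |C|≡|S|         : SameSize C S
    row-distinct    : ∀ i → Injective C._≈_ S._≈_ (L i)
    column-distinct : ∀ j → Injective R._≈_ S._≈_ (λ i → L i j)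

IsAutotopism : (R C S : Setoid a 0ℓ) (L : Carrier R → Carrier C → Carrier S) →
               Inverse R R → Inverse C C → Inverse S S → Set a
IsAutotopism R C S L α β γ =
  ∀ i j → Setoid._≈_ S (to γ (L i j)) (L (to α i) (to β j))

------------------------------------------------------------------------
-- Strongly lcm-closed sets

record StronglyLcmClosed (Λ : Pred ℕ ℓ) : Set ℓ where
  field
    positive   : ¬ Λ 0
    nonempty   : Satisfiable Λ
    lcm-closed : ∀ a b → .{{NonZero a}} → .{{NonZero b}} →
                 Λ (lcm a b) ⇔ (Λ a × Λ b)

------------------------------------------------------------------------
-- Cycle lengths

power : Permutation′ n → ℕ → Fin n → Fin n
power α k i = fold i (α ⟨$⟩ʳ_) k

-- k is the length of the cycle (i, α i, …, αᵏ⁻¹ i) of α containing i.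
record IsCycleLength (α : Permutation′ n) (i : Fin n) (k : ℕ) : Set where
  field
    nonZero : NonZero k
    returns : power α k i ≡ i
    first   : ∀ j → .{{NonZero j}} → j < k → power α j i ≢ i

private
  least : {P : Pred ℕ ℓ} → Decidable P → ∀ k → P k →
          ∃ λ m → P m × (∀ j → j < m → ¬ P j)
  least P? zero    p = 0 , p , λ _ ()
  least P? (suc k) p with P? 0
  ... | yes p₀ = 0 , p₀ , λ _ ()
  ... | no ¬p₀ with m , pₘ , min ← least (P? ∘ suc) k p
    = suc m , pₘ , λ { zero _ → ¬p₀ ; (suc j) (s≤s j<m) → min j j<m }

  power-cancel : (α : Permutation′ n) (i : Fin n) (p d : ℕ) →
                 power α p i ≡ power α (p + d) i → power α d i ≡ i
  power-cancel α i zero    d eq = sym eq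
  power-cancel α i (suc p) d eq = power-cancel α i p d
    (trans (sym (inverseˡ α)) (trans (cong (α ⟨$⟩ˡ_) eq) (inverseˡ α)))

  <⇒+suc : ∀ {p q} → p < q → ∃ λ d → q ≡ p + suc d
  <⇒+suc {zero}  {suc q} _         = q , refl
  <⇒+suc {suc p} {suc q} (s≤s p<q) with d , eq ← <⇒+suc p<q = d , cong suc eq

  someReturn : (α : Permutation′ n) (i : Fin n) → ∃ λ d → power α (suc d) i ≡ i
  someReturn α i
    with p , q , p<q , eq ← pigeonhole ≤-refl (λ k → power α (toℕ k) i)
    with d , q≡p+d ← <⇒+suc p<q
    = d , power-cancel α i (toℕ p) (suc d)
            (subst (λ m → power α (toℕ p) i ≡ power α m i) q≡p+d eq)

cycle : (α : Permutation′ n) (i : Fin n) → ∃ (IsCycleLength α i)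
cycle α i
  with d , eq ← someReturn α i
  with m , eqₘ , min ← least (λ k → power α (suc k) i ≟ i) d eq
  = suc m , record
    { nonZero = _
    ; returns = eqₘ
    ; first   = λ { (suc j) (s≤s j<m) → min j j<m }
    }

cycleLength : Permutation′ n → Fin n → ℕ
cycleLength α i = proj₁ (cycle α i)

-- With α, β, γ in turn for the permutation, these are R_Λ, C_Λ and S_Λ.
OnCycles : Pred ℕ ℓ → Permutation′ n → Pred (Fin n) ℓ
OnCycles Λ α i = Λ (cycleLength α i)

------------------------------------------------------------------------
-- Restrictions of permutations

Closed : Permutation′ n → Pred (Fin n) ℓ → Set ℓ
Closed α X = ∀ i → X i → X (α ⟨$⟩ʳ i)

private
  closed-power : (α : Permutation′ n) (X : Pred (Fin n) ℓ) → Closed α X →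
                 ∀ k i → X i → X (power α k i)
  closed-power α X cl zero    i x = x
  closed-power α X cl (suc k) i x = cl _ (closed-power α X cl k i x)

  closed-inverse : (α : Permutation′ n) (X : Pred (Fin n) ℓ) → Closed α X →
                   ∀ i → X i → X (α ⟨$⟩ˡ i)
  closed-inverse α X cl i x with d , eq ← someReturn α i =
    subst X (trans (sym (inverseˡ α)) (cong (α ⟨$⟩ˡ_) eq))
          (closed-power α X cl d i x)

restrict : (α : Permutation′ n) (X : Pred (Fin n) ℓ) → Closed α X →
           Inverse (Sub X) (Sub X)
restrict α X cl = record
  { to        = λ (i , x) → α ⟨$⟩ʳ i , cl i x
  ; from      = λ (i , x) → α ⟨$⟩ˡ i , closed-inverse α X cl i x
  ; to-cong   = cong (α ⟨$⟩ʳ_)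
  ; from-cong = cong (α ⟨$⟩ˡ_)
  ; inverse   = Inverse.inverseˡ α , Inverse.inverseʳ α
  }

------------------------------------------------------------------------
-- Subsquares

record IsSubsquare (L : Fin n → Fin n → Fin n) (R C S : Pred (Fin n) ℓ) : Set ℓ where
  field
    symbols : ∀ s → S s ⇔ (∃₂ λ i j → R i × C j × L i j ≡ s)

  submatrix : ∃ R → ∃ C → ∃ S
  submatrix (i , r) (j , c) =
    L i j , Equivalence.from (symbols (L i j)) (i , j , r , c , refl)

  field
    isLatinSquare : IsLatinSquare (Sub R) (Sub C) (Sub S) submatrix

record SubsquareWithInducedAutotopism
         (L : Fin n → Fin n → Fin n) (α β γ : Permutation′ n)
         (R C S : Pred (Fin n) ℓ) : Set ℓ where
  field
    isSubsquare  : IsSubsquare L R C S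
    R-closed     : Closed α R
    C-closed     : Closed β C
    S-closed     : Closed γ S
    isAutotopism : IsAutotopism (Sub R) (Sub C) (Sub S)
                     (IsSubsquare.submatrix isSubsquare)
                     (restrict α R R-closed)
                     (restrict β C C-closed)
                     (restrict γ S S-closed)

AtLeastTwoNonempty : (R C S : Pred (Fin n) ℓ) → Set ℓ
AtLeastTwoNonempty R C S =
  (Satisfiable R × Satisfiable C) ⊎
  (Satisfiable R × Satisfiable S) ⊎
  (Satisfiable C × Satisfiable S)

{-# OPTIONS --safe #-}

-- If i, j and s = L(i, j) lie on cycles of lengths a, b and c, then applying
-- θ repeatedly until two of the three have returned returns the third, so each
-- of a, b, c divides the lcm of the other two.  Hence membership in Λ of two of
-- them forces that of the third.  A row i ∈ R_Λ therefore carries C_Λ onto S_Λ,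
-- and a column in C_Λ carries R_Λ onto S_Λ.  In the half-size case, a row
-- outside R_Λ sends the n/2 columns of C_Λ outside S_Λ, and thus fills the
-- complement of S_Λ, so that the remaining columns must carry symbols of S_Λ.

module Submission where

open import Defs
open import Data.Empty using (⊥-elim)
open import Data.Fin.Base using (Fin; zero; suc; splitAt; join)
open import Data.Fin.Permutation using (Permutation′; _⟨$⟩ʳ_; inverseˡ)
open import Data.Fin.Properties using (_≟_; any?; <⇒notInjective; ¬∀⟶∃¬; join-splitAt)
open import Data.Nat.Base using (ℕ; zero; suc; _+_; _*_; _≤_; _<_; NonZero; s≤s; z<s; ≢-nonZero)
open import Data.Nat.Divisibility using (_∣_; divides; ∣-antisym; ∣-refl; m%n≡0⇒n∣m)
open import Data.Nat.DivMod using (_%_; _/_; m≡m%n+[m/n]*n; m%n<n)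
open import Data.Nat.GeneralisedArithmetic using (fold-+)
open import Data.Nat.LCM using (lcm; m∣lcm[m,n]; n∣lcm[m,n]; lcm-least)
open import Data.Nat.Properties using (≤-reflexive; +-identityʳ; m<m+n)
open import Data.Product.Base using (∃; _×_; _,_; proj₁; proj₂)
open import Data.Sum.Base using (_⊎_; inj₁; inj₂; [_,_]′)
open import Function.Base using (_∘_)
open import Function.Bundles using (Inverse; Equivalence; mk⇔)
open import Function.Construct.Composition as Composition using ()
open import Function.Construct.Symmetry as Symmetry using ()
open import Function.Definitions using (Injective)
open import Level using (Level)
open import Relation.Binary.PropositionalEquality using (_≡_; _≢_; refl; sym; trans; cong; cong₂; subst; module ≡-Reasoning)
open import Relation.Nullary using (¬_; yes; no; contradiction)
open import Relation.Nullary.Decidable using (map′; decidable-stable)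
open import Relation.Unary using (Pred; ∁; Decidable; Satisfiable)

private
  variable
    ℓ : Level
    m n : ℕ

-- Injections between finite sets

-- A missed value could be prepended to `f`, giving an injection of `m + 1` points into `n ≤ m`.
injective⇒surjective : {f : Fin m → Fin n} → n ≤ m → Injective _≡_ _≡_ f →
                       ∀ y → ∃ λ x → f x ≡ y
injective⇒surjective {m = m} {n = n} {f = f} n≤m f-inj y with any? (λ x → f x ≟ y)
... | yes hit = hit
... | no miss = ⊥-elim (<⇒notInjective {f = extended} (s≤s n≤m) extended-injective)
  where
  extended : Fin (suc m) → Fin n
  extended zero    = y
  extended (suc x) = f x

  extended-injective : Injective _≡_ _≡_ extended
  extended-injective {zero}  {zero}  _  = refl
  extended-injective {zero}  {suc x} eq = contradiction (x , sym eq) miss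
  extended-injective {suc x} {zero}  eq = contradiction (x , eq) miss
  extended-injective {suc x} {suc z} eq = cong suc (f-inj eq)

splitAt-injective : Injective _≡_ _≡_ (splitAt m {n})
splitAt-injective {m} {n} {x} {y} eq =
  trans (sym (join-splitAt m n x)) (trans (cong (join m n) eq) (join-splitAt m n y))

-- The inverse is that of `f` on the whole of `Fin n`, so nothing has to be counted inside `X` or
-- `Y`, where membership may be undecidable.
injective⇒sameSize : {X Y : Pred (Fin n) ℓ} {f : Fin n → Fin n} → Injective _≡_ _≡_ f →
                     (∀ i → X i → Y (f i)) → (∀ i → Y (f i) → X i) →
                     SameSize (Sub X) (Sub Y)
injective⇒sameSize {X = X} {Y = Y} {f = f} f-inj X⇒Y Y⇒X = record
  { to        = λ (i , x) → f i , X⇒Y i x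
  ; from      = λ (s , y) → f⁻¹ s , Y⇒X (f⁻¹ s) (subst Y (sym (f-f⁻¹ s)) y)
  ; to-cong   = cong f
  ; from-cong = cong f⁻¹
  ; inverse   = (λ { {s , _} refl → f-f⁻¹ s })
              , (λ { {i , _} refl → f-inj (f-f⁻¹ (f i)) })
  }
  where
  surj = injective⇒surjective (≤-reflexive refl) f-inj
  f⁻¹ = λ s → proj₁ (surj s)
  f-f⁻¹ = λ s → proj₂ (surj s)

-- Subsets of known size

module _ {X : Pred (Fin n) ℓ} (|X|≡m : HasSize (Sub X) m) where
  open Inverse |X|≡m

  element : Fin m → Fin n
  element t = proj₁ (from t)

  element∈ : ∀ t → X (element t)
  element∈ t = proj₂ (from t)

  element-injective : Injective _≡_ _≡_ element
  element-injective {t} {u} eq =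
    trans (sym (strictlyInverseˡ t)) (trans (to-cong eq) (strictlyInverseˡ u))

  -- The bijection lists the elements of `X`, and the list can be searched. This is the source of
  -- decidability for the sets arising from an arbitrary `Λ`.
  hasSize⇒decidable : Decidable X
  hasSize⇒decidable i = map′
    (λ (t , eq) → subst X eq (element∈ t))
    (λ x → to (i , x) , strictlyInverseʳ (i , x))
    (any? (λ t → element t ≟ i))

  hasSize<⇒∁-nonempty : m < n → Satisfiable (∁ X)
  hasSize<⇒∁-nonempty m<n = ¬∀⟶∃¬ n X hasSize⇒decidable λ all →
    <⇒notInjective {f = λ i → to (i , all i)} m<n
      λ {i} {j} eq → trans (sym (strictlyInverseʳ (i , all i)))
                       (trans (from-cong eq) (strictlyInverseʳ (j , all j)))

-- Cycle lengths

module _ (α : Permutation′ n) where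

  ⟨$⟩ʳ-injective : Injective _≡_ _≡_ (α ⟨$⟩ʳ_)
  ⟨$⟩ʳ-injective eq = trans (sym (inverseˡ α)) (trans (cong (Inverse.from α) eq) (inverseˡ α))

  power-shift : ∀ d i → power α d (α ⟨$⟩ʳ i) ≡ α ⟨$⟩ʳ power α d i
  power-shift zero    i = refl
  power-shift (suc d) i = cong (α ⟨$⟩ʳ_) (power-shift d i)

  power-* : ∀ {i} k → power α k i ≡ i → ∀ q → power α (q * k) i ≡ i
  power-* {i} k returns zero    = refl
  power-* {i} k returns (suc q) = begin
    power α (k + q * k) i         ≡⟨ fold-+ i (α ⟨$⟩ʳ_) k ⟩
    power α k (power α (q * k) i) ≡⟨ cong (power α k) (power-* k returns q) ⟩
    power α k i                   ≡⟨ returns ⟩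
    i                             ∎
    where open ≡-Reasoning

  module _ (i : Fin n) where
    open IsCycleLength (proj₂ (cycle α i))

    instance
      cycleLength-nonZero : NonZero (cycleLength α i)
      cycleLength-nonZero = nonZero

    cycleLength∣⇒returns : ∀ d → cycleLength α i ∣ d → power α d i ≡ i
    cycleLength∣⇒returns _ (divides q refl) = power-* _ returns q

    -- The remainder of `d` modulo the cycle length is again a return time, and minimality of the
    -- cycle length makes it zero.
    returns⇒cycleLength∣ : ∀ d → power α d i ≡ i → cycleLength α i ∣ d
    returns⇒cycleLength∣ d eq = m%n≡0⇒n∣m d k (remainder≡0 (d % k) (m%n<n d k) remainder-returns)
      where
      k = cycleLength α i

      remainder-returns : power α (d % k) i ≡ i
      remainder-returns = begin
        power α (d % k) i                         ≡⟨ cong (power α (d % k)) (power-* k returns (d / k)) ⟨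
        power α (d % k) (power α (d / k * k) i)   ≡⟨ fold-+ i (α ⟨$⟩ʳ_) (d % k) ⟨
        power α (d % k + d / k * k) i             ≡⟨ cong (λ e → power α e i) (m≡m%n+[m/n]*n d k) ⟨
        power α d i                               ≡⟨ eq ⟩
        i                                         ∎
        where open ≡-Reasoning

      remainder≡0 : ∀ r → r < k → power α r i ≡ i → r ≡ 0
      remainder≡0 zero    _   _  = refl
      remainder≡0 (suc r) r<k eq = contradiction eq (first (suc r) r<k)

  -- Since `α` commutes with its powers, `i` and its image have the same return times.
  cycleLength-shift : ∀ i → cycleLength α (α ⟨$⟩ʳ i) ≡ cycleLength α i
  cycleLength-shift i = ∣-antisym
    (returns⇒cycleLength∣ (α ⟨$⟩ʳ i) k
      (trans (power-shift k i) (cong (α ⟨$⟩ʳ_) (cycleLength∣⇒returns i k ∣-refl))))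
    (returns⇒cycleLength∣ i k′
      (⟨$⟩ʳ-injective (trans (sym (power-shift k′ i)) (cycleLength∣⇒returns (α ⟨$⟩ʳ i) k′ ∣-refl))))
    where
    k  = cycleLength α i
    k′ = cycleLength α (α ⟨$⟩ʳ i)

  OnCycles-closed : (Λ : Pred ℕ ℓ) → Closed α (OnCycles Λ α)
  OnCycles-closed Λ i = subst Λ (sym (cycleLength-shift i))

  ∁OnCycles-closed : (Λ : Pred ℕ ℓ) → Closed α (∁ (OnCycles Λ α))
  ∁OnCycles-closed Λ i i∉ = i∉ ∘ subst Λ (cycleLength-shift i)

-- Closure puts `lcm a b` into `Λ`. As `c` divides it, it equals its own lcm with `c`, and closure
-- read in the other direction releases `c`.
∣lcm-closed : {Λ : Pred ℕ ℓ} → StronglyLcmClosed Λ →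
              ∀ a b c → .{{NonZero a}} → .{{NonZero b}} → .{{NonZero c}} →
              Λ a → Λ b → c ∣ lcm a b → Λ c
∣lcm-closed {Λ = Λ} Λ-closed a b c a∈Λ b∈Λ c∣lcm =
  proj₂ (Equivalence.to (lcm-closed (lcm a b) c) (subst Λ lcm≡ lcm∈Λ))
  where
  open StronglyLcmClosed Λ-closed

  lcm∈Λ : Λ (lcm a b)
  lcm∈Λ = Equivalence.from (lcm-closed a b) (a∈Λ , b∈Λ)

  instance
    -- Closure speaks of positive numbers only; `lcm a b` is one because it lies in `Λ` and 0 does
    -- not.
    lcm-nonZero : NonZero (lcm a b)
    lcm-nonZero = ≢-nonZero λ eq → positive (subst Λ eq lcm∈Λ)

  lcm≡ : lcm a b ≡ lcm (lcm a b) c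
  lcm≡ = ∣-antisym (m∣lcm[m,n] (lcm a b) c) (lcm-least ∣-refl c∣lcm)

-- Latin squares

-- The two-out-of-three property of each cell. All four subsquares are built from it, first for the
-- sets given by `Λ` and then with two of them complemented.
record Triad (L : Fin n → Fin n → Fin n) (R C S : Pred (Fin n) ℓ) : Set ℓ where
  field
    symbol∈ : ∀ i j → R i → C j → S (L i j)
    column∈ : ∀ i j → R i → S (L i j) → C j
    row∈    : ∀ i j → C j → S (L i j) → R i

module _ {L : Fin n → Fin n → Fin n} (latin : IsLatinSquare [ n ] [ n ] [ n ] L) where
  open IsLatinSquare latin

  symbolInRow : ∀ i s → ∃ λ j → L i j ≡ s
  symbolInRow i = injective⇒surjective (≤-reflexive refl) (row-distinct i)

  symbolInColumn : ∀ j s → ∃ λ i → L i j ≡ s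
  symbolInColumn j = injective⇒surjective (≤-reflexive refl) (column-distinct j)

  module _ {R C S : Pred (Fin n) ℓ} (triad : Triad L R C S) where
    open Triad triad

    twoNonempty⇒row×column : AtLeastTwoNonempty R C S → Satisfiable R × Satisfiable C
    twoNonempty⇒row×column (inj₁ both) = both
    twoNonempty⇒row×column (inj₂ (inj₁ ((i , i∈R) , (s , s∈S)))) =
      let j , eq = symbolInRow i s in (i , i∈R) , (j , column∈ i j i∈R (subst S (sym eq) s∈S))
    twoNonempty⇒row×column (inj₂ (inj₂ ((j , j∈C) , (s , s∈S)))) =
      let i , eq = symbolInColumn j s in (i , row∈ i j j∈C (subst S (sym eq) s∈S)) , (j , j∈C)

    columns↔symbols : Satisfiable R → SameSize (Sub C) (Sub S)
    columns↔symbols (i , i∈R) = injective⇒sameSize (row-distinct i)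
      (λ j j∈C → symbol∈ i j i∈R j∈C) (λ j → column∈ i j i∈R)

    rows↔symbols : Satisfiable C → SameSize (Sub R) (Sub S)
    rows↔symbols (j , j∈C) = injective⇒sameSize (column-distinct j)
      (λ i i∈R → symbol∈ i j i∈R j∈C) (λ i → row∈ i j j∈C)

    rows↔columns : Satisfiable R × Satisfiable C → SameSize (Sub R) (Sub C)
    rows↔columns (row , column) =
      Composition.inverse (rows↔symbols column) (Symmetry.inverse (columns↔symbols row))

    triad⇒isSubsquare : SameSize (Sub R) (Sub C) → SameSize (Sub C) (Sub S) →
                        IsSubsquare L R C S
    triad⇒isSubsquare R↔C C↔S = record
      { symbols = λ s → mk⇔
          (λ s∈S →
            -- Any row of `R` would do; carrying `s` back along the bijections supplies one.
            let i , i∈R = Inverse.from R↔C (Inverse.from C↔S (s , s∈S))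
                j , eq  = symbolInRow i s
            in i , j , i∈R , column∈ i j i∈R (subst S (sym eq) s∈S) , eq)
          (λ { (i , j , i∈R , j∈C , refl) → symbol∈ i j i∈R j∈C })
      ; isLatinSquare = record
          { L-cong          = cong₂ L
          ; finite          = n , record { to = proj₁ ; cong = λ eq → eq ; injective = λ eq → eq }
          ; |R|≡|C|         = R↔C
          ; |C|≡|S|         = C↔S
          ; row-distinct    = λ (i , _) → row-distinct i
          ; column-distinct = λ (j , _) → column-distinct j
          }
      }

    -- Triads of half size and their complements

    module _ {k : ℕ} (2*k≡n : 2 * k ≡ n)
             (|R|≡k : HasSize (Sub R) k) (|C|≡k : HasSize (Sub C) k) (|S|≡k : HasSize (Sub S) k)
             where

      n≤k+k : n ≤ k + k
      n≤k+k = ≤-reflexive (trans (sym 2*k≡n) (cong (k +_) (+-identityʳ k)))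

      -- The `k` symbols of `S` followed by the `k` entries of row `i` in the columns of `C`. For a
      -- row outside `R` these are `2 * k` distinct symbols, hence all symbols.
      symbolOrEntry : Fin n → Fin k ⊎ Fin k → Fin n
      symbolOrEntry i = [ element |S|≡k , L i ∘ element |C|≡k ]′

      module _ (i : Fin n) (i∉R : ¬ R i) where

        symbol≢entry : ∀ s c → element |S|≡k s ≢ L i (element |C|≡k c)
        symbol≢entry s c eq =
          i∉R (row∈ i _ (element∈ |C|≡k c) (subst S eq (element∈ |S|≡k s)))

        symbolOrEntry-injective : Injective _≡_ _≡_ (symbolOrEntry i)
        symbolOrEntry-injective {inj₁ s} {inj₁ t} eq = cong inj₁ (element-injective |S|≡k eq)
        symbolOrEntry-injective {inj₁ s} {inj₂ c} eq = contradiction eq (symbol≢entry s c)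
        symbolOrEntry-injective {inj₂ c} {inj₁ s} eq = contradiction (sym eq) (symbol≢entry s c)
        symbolOrEntry-injective {inj₂ c} {inj₂ d} eq =
          cong inj₂ (element-injective |C|≡k (row-distinct i eq))

        complementary-symbol∈ : ∀ j → ¬ C j → S (L i j)
        complementary-symbol∈ j j∉C
          with t , eq ← injective⇒surjective n≤k+k (splitAt-injective {k} ∘ symbolOrEntry-injective) (L i j)
          with splitAt k t
        ... | inj₁ s = subst S eq (element∈ |S|≡k s)
        -- The symbol would then occur in row `i` both at `j` and at a column of `C`.
        ... | inj₂ c = contradiction (subst C (row-distinct i eq) (element∈ |C|≡k c)) j∉C

      ∁-triad-symbols : Triad L (∁ R) (∁ C) S
      ∁-triad-symbols = record
        { symbol∈ = λ i j i∉R j∉C → complementary-symbol∈ i i∉R j j∉C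
        ; column∈ = λ i j i∉R s∈S j∈C → i∉R (row∈ i j j∈C s∈S)
        ; row∈    = λ i j j∉C s∈S i∈R → j∉C (column∈ i j i∈R s∈S)
        }

      ∁-triad-rows : Triad L R (∁ C) (∁ S)
      ∁-triad-rows = record
        { symbol∈ = λ i j i∈R j∉C s∈S → j∉C (column∈ i j i∈R s∈S)
        ; column∈ = λ i j i∈R s∉S j∈C → s∉S (symbol∈ i j i∈R j∈C)
        -- The counting argument only refutes `¬ R i`; the known size of `R` makes membership
        -- decidable and removes the double negation.
        ; row∈    = λ i j j∉C s∉S → decidable-stable (hasSize⇒decidable |R|≡k i)
                      λ i∉R → s∉S (complementary-symbol∈ i i∉R j j∉C)
        }

      ∁-triad-columns : Triad L (∁ R) C (∁ S)
      ∁-triad-columns = record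
        { symbol∈ = λ i j i∉R j∈C s∈S → i∉R (row∈ i j j∈C s∈S)
        ; column∈ = λ i j i∉R s∉S → decidable-stable (hasSize⇒decidable |C|≡k j)
                      λ j∉C → s∉S (complementary-symbol∈ i i∉R j j∉C)
        ; row∈    = λ i j j∈C s∉S i∈R → s∉S (symbol∈ i j i∈R j∈C)
        }

-- Autotopisms

module _ {L : Fin n → Fin n → Fin n} (latin : IsLatinSquare [ n ] [ n ] [ n ] L)
         (α β γ : Permutation′ n) (θ : IsAutotopism [ n ] [ n ] [ n ] L α β γ) where
  open IsLatinSquare latin

  power-autotopism : ∀ d i j → power γ d (L i j) ≡ L (power α d i) (power β d j)
  power-autotopism zero    i j = refl
  power-autotopism (suc d) i j = trans (cong (γ ⟨$⟩ʳ_) (power-autotopism d i j)) (θ _ _)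

  module _ (i j : Fin n) where
    private
      a = cycleLength α i
      b = cycleLength β j
      c = cycleLength γ (L i j)

    symbolCycle∣ : c ∣ lcm a b
    symbolCycle∣ = returns⇒cycleLength∣ γ _ d (trans (power-autotopism d i j)
      (cong₂ L (cycleLength∣⇒returns α i d (m∣lcm[m,n] a b)) (cycleLength∣⇒returns β j d (n∣lcm[m,n] a b))))
      where d = lcm a b

    columnCycle∣ : b ∣ lcm a c
    -- After `d` steps the row and the symbol are back, so row `i` holds the same symbol in columns
    -- `power β d j` and `j`, which must coincide.
    columnCycle∣ = returns⇒cycleLength∣ β j d (row-distinct i (begin
      L i (power β d j)             ≡⟨ cong (λ r → L r (power β d j)) (cycleLength∣⇒returns α i d (m∣lcm[m,n] a c)) ⟨
      L (power α d i) (power β d j) ≡⟨ power-autotopism d i j ⟨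
      power γ d (L i j)             ≡⟨ cycleLength∣⇒returns γ _ d (n∣lcm[m,n] a c) ⟩
      L i j                         ∎))
      where
      open ≡-Reasoning
      d = lcm a c

    rowCycle∣ : a ∣ lcm b c
    rowCycle∣ = returns⇒cycleLength∣ α i d (column-distinct j (begin
      L (power α d i) j             ≡⟨ cong (L (power α d i)) (cycleLength∣⇒returns β j d (m∣lcm[m,n] b c)) ⟨
      L (power α d i) (power β d j) ≡⟨ power-autotopism d i j ⟨
      power γ d (L i j)             ≡⟨ cycleLength∣⇒returns γ _ d (n∣lcm[m,n] b c) ⟩
      L i j                         ∎))
      where
      open ≡-Reasoning
      d = lcm b c

  OnCycles-triad : {Λ : Pred ℕ ℓ} → StronglyLcmClosed Λ →
                   Triad L (OnCycles Λ α) (OnCycles Λ β) (OnCycles Λ γ)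
  OnCycles-triad Λ-closed = record
    { symbol∈ = λ i j a∈Λ b∈Λ → ∣lcm-closed Λ-closed (cycleLength α i) (cycleLength β j) _
        {{cycleLength-nonZero α i}} {{cycleLength-nonZero β j}} {{cycleLength-nonZero γ _}}
        a∈Λ b∈Λ (symbolCycle∣ i j)
    ; column∈ = λ i j a∈Λ c∈Λ → ∣lcm-closed Λ-closed (cycleLength α i) (cycleLength γ _) _
        {{cycleLength-nonZero α i}} {{cycleLength-nonZero γ _}} {{cycleLength-nonZero β j}}
        a∈Λ c∈Λ (columnCycle∣ i j)
    ; row∈    = λ i j b∈Λ c∈Λ → ∣lcm-closed Λ-closed (cycleLength β j) (cycleLength γ _) _
        {{cycleLength-nonZero β j}} {{cycleLength-nonZero γ _}} {{cycleLength-nonZero α i}}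
        b∈Λ c∈Λ (rowCycle∣ i j)
    }

  inducedSubsquare : {R C S : Pred (Fin n) ℓ} → Triad L R C S →
                     Closed α R → Closed β C → Closed γ S →
                     SameSize (Sub R) (Sub C) → SameSize (Sub C) (Sub S) →
                     SubsquareWithInducedAutotopism L α β γ R C S
  inducedSubsquare triad R-closed C-closed S-closed R↔C C↔S = record
    { isSubsquare  = triad⇒isSubsquare latin triad R↔C C↔S
    ; R-closed     = R-closed
    ; C-closed     = C-closed
    ; S-closed     = S-closed
    ; isAutotopism = λ (i , _) (j , _) → θ i j
    }

  -- The size bijections come from a row and a column of the triad. In order 0 there are none to
  -- choose, and the identity serves instead.
  inducedSubsquareFrom : {R C S : Pred (Fin n) ℓ} → Triad L R C S →
                         Closed α R → Closed β C → Closed γ S →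
                         (Satisfiable R × Satisfiable C) ⊎ n ≡ 0 →
                         SubsquareWithInducedAutotopism L α β γ R C S
  inducedSubsquareFrom triad R-closed C-closed S-closed (inj₁ nonempty) =
    inducedSubsquare triad R-closed C-closed S-closed
      (rows↔columns latin triad nonempty) (columns↔symbols latin triad (proj₁ nonempty))
  inducedSubsquareFrom triad R-closed C-closed S-closed (inj₂ refl) =
    inducedSubsquare triad R-closed C-closed S-closed
      (injective⇒sameSize {f = λ i → i} (λ eq → eq) (λ ()) (λ ()))
      (injective⇒sameSize {f = λ i → i} (λ eq → eq) (λ ()) (λ ()))

-- Nonemptiness at half size, and the conclusion

half-satisfiable : {X : Pred (Fin n) ℓ} (k : ℕ) → 2 * k ≡ n → HasSize (Sub X) k →
                   (Satisfiable X × Satisfiable (∁ X)) ⊎ n ≡ 0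
half-satisfiable zero    refl _     = inj₂ refl
half-satisfiable (suc k) refl |X|≡k =
  inj₁ ((element |X|≡k zero , element∈ |X|≡k zero) ,
        -- `2 * suc k` unfolds to `suc k + (suc k + 0)`, with a positive second summand, so `X`
        -- misses some element.
        hasSize<⇒∁-nonempty |X|≡k (m<m+n (suc k) z<s))

theorem3p7 : ∀ {ℓ : Level} (n : ℕ) (L : Fin n → Fin n → Fin n) →
  IsLatinSquare [ n ] [ n ] [ n ] L →
  (α β γ : Permutation′ n) → IsAutotopism [ n ] [ n ] [ n ] L α β γ →
  (Λ : Pred ℕ ℓ) → StronglyLcmClosed Λ →
  let R = OnCycles Λ α
      C = OnCycles Λ β
      S = OnCycles Λ γ
  in
  (AtLeastTwoNonempty R C S →
    SameSize (Sub R) (Sub C) × SameSize (Sub C) (Sub S) ×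
    SubsquareWithInducedAutotopism L α β γ R C S)
  ×
  ((k : ℕ) → 2 * k ≡ n →
    HasSize (Sub R) k → HasSize (Sub C) k → HasSize (Sub S) k →
    SubsquareWithInducedAutotopism L α β γ R C S ×
    SubsquareWithInducedAutotopism L α β γ R (∁ C) (∁ S) ×
    SubsquareWithInducedAutotopism L α β γ (∁ R) C (∁ S) ×
    SubsquareWithInducedAutotopism L α β γ (∁ R) (∁ C) S)
theorem3p7 n L latin α β γ θ Λ Λ-closed = quarter , quarters
  where
  R = OnCycles Λ α
  C = OnCycles Λ β
  S = OnCycles Λ γ

  R-closed = OnCycles-closed α Λ
  C-closed = OnCycles-closed β Λ
  S-closed = OnCycles-closed γ Λ
  ∁R-closed = ∁OnCycles-closed α Λ
  ∁C-closed = ∁OnCycles-closed β Λ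
  ∁S-closed = ∁OnCycles-closed γ Λ

  triad : Triad L R C S
  triad = OnCycles-triad latin α β γ θ Λ-closed

  quarter : AtLeastTwoNonempty R C S →
            SameSize (Sub R) (Sub C) × SameSize (Sub C) (Sub S) ×
            SubsquareWithInducedAutotopism L α β γ R C S
  quarter twoNonempty =
    R↔C , C↔S , inducedSubsquare latin α β γ θ triad R-closed C-closed S-closed R↔C C↔S
    where
    nonempty = twoNonempty⇒row×column latin triad twoNonempty
    R↔C = rows↔columns latin triad nonempty
    C↔S = columns↔symbols latin triad (proj₁ nonempty)

  quarters : (k : ℕ) → 2 * k ≡ n →
             HasSize (Sub R) k → HasSize (Sub C) k → HasSize (Sub S) k →
             SubsquareWithInducedAutotopism L α β γ R C S ×
             SubsquareWithInducedAutotopism L α β γ R (∁ C) (∁ S) ×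
             SubsquareWithInducedAutotopism L α β γ (∁ R) C (∁ S) ×
             SubsquareWithInducedAutotopism L α β γ (∁ R) (∁ C) S
  quarters k 2*k≡n |R|≡k |C|≡k |S|≡k =
    inducedSubsquareFrom latin α β γ θ triad R-closed C-closed S-closed
      (both proj₁ proj₁) ,
    inducedSubsquareFrom latin α β γ θ (∁-triad-rows latin triad 2*k≡n |R|≡k |C|≡k |S|≡k)
      R-closed ∁C-closed ∁S-closed (both proj₁ proj₂) ,
    inducedSubsquareFrom latin α β γ θ (∁-triad-columns latin triad 2*k≡n |R|≡k |C|≡k |S|≡k)
      ∁R-closed C-closed ∁S-closed (both proj₂ proj₁) ,
    inducedSubsquareFrom latin α β γ θ (∁-triad-symbols latin triad 2*k≡n |R|≡k |C|≡k |S|≡k)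
      ∁R-closed ∁C-closed S-closed (both proj₂ proj₂)
    where
    -- The projections passed as `f` and `g` select a set or its complement, for rows and columns
    -- independently.
    both : ∀ {A B : Set _} → (Satisfiable R × Satisfiable (∁ R) → A) →
           (Satisfiable C × Satisfiable (∁ C) → B) → (A × B) ⊎ n ≡ 0
    both f g with half-satisfiable k 2*k≡n |R|≡k | half-satisfiable k 2*k≡n |C|≡k
    ... | inj₂ n≡0 | _        = inj₂ n≡0
    ... | inj₁ _   | inj₂ n≡0 = inj₂ n≡0
    ... | inj₁ r   | inj₁ c   = inj₁ (f r , g c)
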